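{- Let $\mathbb{S}\subseteq\mathbb{R}$ be an $\aleph_1$-dense subchain of the real line of cardinality $\aleph_1$ without end points, let $\leq_{\omega_1}$ be a total order on $\mathbb{S}$ of order type $\omega_1$, and let $\le$ be the Sierpinskization order on $\mathbb{S}$, i.e. the intersection of $\leq_{\omega_1}$ and the usual order $\leq_{\mathbb{R}}$. Then the lattice $L(\mathbb{S},\leq)$ has the chain-gap property, but it does not have the selection property.
   Context: A subset $\mathbb{S}\subseteq\mathbb{R}$ is $\aleph_1$-dense if $|\,]a,b[\,\cap\mathbb{S}|\ge\aleph_1$ for all $a<b$ in $\mathbb{S}$. Let $\le_{\mathbb{R}}$ be the usual order of the reals restricted to $\mathbb{S}$. The order $\le$ on $\mathbb{S}$ is defined by: $x\le y$ iff $x\leq_{\omega_1}y$ and $x\leq_{\mathbb{R}}y$. For $x\in\mathbb{S}$ put $\downarrow x=\{y\in\mathbb{S}: y\le x\}$. $L(\mathbb{S},\le)$ is the sublattice of the lattice of all subsets of $\mathbb{S}$ (with union and intersection, ordered by inclusion) generated by the sets $\downarrow x$, $x\in\mathbb{S}$; it consists of all finite unions of finite intersections (each nonempty as a union, resp. intersection) of sets $\downarrow x$. For a poset $P$ and $C\subseteq P$, let $C^*=\{x\in P: y\le x \text{ for all } y\in C\}$ and $C_*=\{x\in P: x\le y\text{ for all }y\in C\}$ (so $\emptyset^*=\emptyset_*=P$). A pair $(A,B)$ of subsets of $P$ is a pregap if $A\subseteq B_*$. A pregap is separable if $A^*\cap B_*\neq\emptyset$; otherwise it is a gap of $P$. $B(P)$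 is the set of separable pregaps of $P$, quasiordered by: $(A,B)\le(A',B')$ iff every $a\in A$ is $\le$ some $a'\in A'$ and every $b\in B$ is $\ge$ some $b'\in B'$. $P$ has the selection property if there is an order-preserving map $\varphi:B(P)\to P$ with $\varphi(A,B)\in A^*\cap B_*$ for every $(A,B)\in B(P)$. An order-preserving map $g:P\to Q$ preserves a gap $(A,B)$ of $P$ if $(g[A],g[B])$ is a gap of $Q$. $P$ has the chain-gap property if for each gap of $P$ there are a chain (totally ordered set) $Q$ and an order-preserving map $g:P\to Q$ preserving that gap. -}

module Defs where

open import Data.Nat.Base using (ℕ)
open import Data.Product.Base using (Σ-syntax; ∃; _×_; proj₁)
open import Data.Rational.Base using (ℚ; _<_)
open import Function.Bundles using (Injection; Bijection)
open import Induction.WellFounded using (WellFounded)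
open import Level using (Level; _⊔_; suc; 0ℓ)
open import Relation.Binary.Bundles using (Setoid; Poset; TotalOrder)
open import Relation.Binary.Core using (Rel)
open import Relation.Binary.Definitions using (Monotonic₁)
open import Relation.Binary.Morphism.Bundles using (PosetHomomorphism)
open import Relation.Binary.PropositionalEquality using () renaming (setoid to ≡-setoid)
open import Relation.Binary.Structures using (IsTotalOrder)
open import Relation.Nullary.Negation using (¬_)
open import Relation.Unary using (Pred; _∈_; _∉_; _⊆_; _≐_; _∩_; _∪_; Satisfiable)
open import Relation.Unary.Relation.Binary.Subset using (⊆-poset)
import Relation.Binary.Construct.Intersection as Intersection
import Relation.Binary.Construct.NonStrictToStrict as Strict
import Relation.Binary.Construct.On as On

private
  variable
    a c ℓ ℓ₁ ℓ₂ p : Level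

-- Throughout, subsets are predicates.  A predicate on a setoid stands for its
-- closure under the setoid equality; every notion below depends only on that
-- closure, so predicates are not required to respect the equality.

------------------------------------------------------------------------
-- Cardinality and the order type ω₁

subsetoid : (X : Setoid c ℓ) → Pred (Setoid.Carrier X) p → Setoid (c ⊔ p) ℓ
subsetoid X P = On.setoid X (proj₁ {B = P})

Countable : Setoid c ℓ → Set (c ⊔ ℓ)
Countable X = Injection X (≡-setoid ℕ)

-- ω₁ is the least uncountable ordinal: an uncountable well-order all of whose
-- proper initial segments (the smaller ordinals) are countable.
record HasOrderTypeω₁ (X : Setoid c ℓ₁) (_≤_ : Rel (Setoid.Carrier X) ℓ₂)
                      : Set (c ⊔ ℓ₁ ⊔ ℓ₂) where
  open Setoid X
  open Strict _≈_ _≤_ using () renaming (_<_ to _≺_)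
  field
    isTotalOrder     : IsTotalOrder _≈_ _≤_
    wellFounded      : WellFounded _≺_
    uncountable      : ¬ Countable X
    segmentCountable : ∀ x → Countable (subsetoid X (λ y → y ≺ x))

-- ℵ₁ is the cardinality of the sets that can be ordered in type ω₁.
Cardinality≥ℵ₁ : Setoid c ℓ → Set (suc (c ⊔ ℓ))
Cardinality≥ℵ₁ {c} {ℓ} X =
  Σ[ W ∈ Setoid c ℓ ] Σ[ R ∈ Rel (Setoid.Carrier W) ℓ ]
    HasOrderTypeω₁ W R × Injection W X

Cardinality≡ℵ₁ : Setoid c ℓ → Set (suc (c ⊔ ℓ))
Cardinality≡ℵ₁ {c} {ℓ} X =
  Σ[ W ∈ Setoid c ℓ ] Σ[ R ∈ Rel (Setoid.Carrier W) ℓ ]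
    HasOrderTypeω₁ W R × Bijection W X

------------------------------------------------------------------------
-- The real line and its subsets

-- Classical Dedekind cuts, given by their lower halves.
record ℝ : Set₁ where
  field
    lower      : Pred ℚ 0ℓ
    nonempty   : Satisfiable lower
    proper     : ∃ λ q → q ∉ lower
    downClosed : ∀ {p q} → p < q → q ∈ lower → p ∈ lower
    noMaximum  : ∀ {p} → p ∈ lower → ∃ λ q → p < q × q ∈ lower

ℝ-poset : Poset (suc 0ℓ) 0ℓ 0ℓ
ℝ-poset = On.poset (⊆-poset ℚ 0ℓ) ℝ.lower

module Subchain (𝕊 : Pred ℝ 0ℓ) where

  chain : Poset (suc 0ℓ) 0ℓ 0ℓ
  chain = On.poset ℝ-poset (proj₁ {B = 𝕊})

  open Poset chain public
    using (Carrier; _≈_)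
    renaming (_≤_ to _≤ᴿ_; isPartialOrder to ≤ᴿ-isPartialOrder)

  open Strict _≈_ _≤ᴿ_ public using () renaming (_<_ to _<ᴿ_)

  setoid : Setoid (suc 0ℓ) 0ℓ
  setoid = Poset.Eq.setoid chain

  ]_,_[ : Carrier → Carrier → Pred Carrier 0ℓ
  ] x , y [ z = x <ᴿ z × z <ᴿ y

  ℵ₁-Dense : Set (suc (suc 0ℓ))
  ℵ₁-Dense = ∀ x y → x <ᴿ y → Cardinality≥ℵ₁ (subsetoid setoid ] x , y [)

  WithoutEndpoints : Set (suc 0ℓ)
  WithoutEndpoints = ∀ x → (∃ λ y → y <ᴿ x) × (∃ λ z → x <ᴿ z)

  Sierpinskization : (_≤ω₁_ : Rel Carrier 0ℓ) → HasOrderTypeω₁ setoid _≤ω₁_ →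
                     Poset (suc 0ℓ) 0ℓ 0ℓ
  Sierpinskization _≤ω₁_ h = record
    { _≤_            = _≤ω₁_ Intersection.∩ _≤ᴿ_
    ; isPartialOrder = Intersection.isPartialOrderʳ
        (IsTotalOrder.isPreorder (HasOrderTypeω₁.isTotalOrder h))
        ≤ᴿ-isPartialOrder
    }

------------------------------------------------------------------------
-- The lattice of sets generated by the principal initial segments

module _ (P : Poset c ℓ₁ ℓ₂) where
  open Poset P

  ↓ : Carrier → Pred Carrier ℓ₂
  ↓ x y = y ≤ x

  -- The constructor resp makes this a family of sets rather than of
  -- predicates.
  data Generated : Pred Carrier ℓ₂ → Set (c ⊔ suc ℓ₂) where
    gen  : ∀ x → Generated (↓ x)
    _∪ᴳ_ : ∀ {U V} → Generated U → Generated V → Generated (U ∪ V)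
    _∩ᴳ_ : ∀ {U V} → Generated U → Generated V → Generated (U ∩ V)
    resp : ∀ {U V} → U ≐ V → Generated U → Generated V

  L : Poset (c ⊔ suc ℓ₂) (c ⊔ ℓ₂) (c ⊔ ℓ₂)
  L = On.poset (⊆-poset Carrier ℓ₂) (proj₁ {B = Generated})

------------------------------------------------------------------------
-- Gaps

module Gaps (P : Poset c ℓ₁ ℓ₂) where
  open Poset P

  infix 10 _^* _₍*₎

  _^* : Pred Carrier a → Pred Carrier (c ⊔ ℓ₂ ⊔ a)
  (C ^*) x = ∀ y → y ∈ C → y ≤ x

  _₍*₎ : Pred Carrier a → Pred Carrier (c ⊔ ℓ₂ ⊔ a)
  (C ₍*₎) x = ∀ y → y ∈ C → x ≤ y

  Pregap : Pred Carrier a → Pred Carrier a → Set (c ⊔ ℓ₂ ⊔ a)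
  Pregap A B = A ⊆ B ₍*₎

  Separable : Pred Carrier a → Pred Carrier a → Set (c ⊔ ℓ₂ ⊔ a)
  Separable A B = Satisfiable (A ^* ∩ B ₍*₎)

  Gap : Pred Carrier a → Pred Carrier a → Set (c ⊔ ℓ₂ ⊔ a)
  Gap A B = Pregap A B × ¬ Separable A B

  record SeparablePregap (a : Level) : Set (c ⊔ ℓ₂ ⊔ suc a) where
    field
      A B       : Pred Carrier a
      pregap    : Pregap A B
      separable : Separable A B

  -- Larger pairs have more demanding sets on both sides: the order on the
  -- second components is not reversed.
  _⊑_ : Rel (SeparablePregap a) (c ⊔ ℓ₂ ⊔ a)
  S ⊑ T = (∀ x → x ∈ S.A → ∃ λ x′ → x′ ∈ T.A × x ≤ x′)
        × (∀ y → y ∈ S.B → ∃ λ y′ → y′ ∈ T.B × y′ ≤ y)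
    where
    module S = SeparablePregap S
    module T = SeparablePregap T

module _ (P : Poset c ℓ₁ ℓ₂) where
  open Poset P
  open Gaps P

  -- The level a bounds the universe in which the subsets A and B live.
  SelectionProperty : (a : Level) → Set (c ⊔ ℓ₂ ⊔ suc a)
  SelectionProperty a =
    Σ[ φ ∈ (SeparablePregap a → Carrier) ]
      Monotonic₁ _⊑_ _≤_ φ × (∀ S → φ S ∈ A S ^* ∩ B S ₍*₎)
    where open SeparablePregap

  module _ (Q : TotalOrder c ℓ₁ ℓ₂) where
    private module Q = TotalOrder Q

    image : (Carrier → Q.Carrier) → Pred Carrier a → Pred Q.Carrier (c ⊔ ℓ₁ ⊔ a)
    image g C q = ∃ λ x → x ∈ C × g x Q.≈ q

    PreservesGap : PosetHomomorphism P Q.poset →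
                   Pred Carrier a → Pred Carrier a → Set (c ⊔ ℓ₁ ⊔ ℓ₂ ⊔ a)
    PreservesGap g A B = Gaps.Gap Q.poset (image ⟦_⟧ A) (image ⟦_⟧ B)
      where open PosetHomomorphism g

  -- Taking Q at the levels of P is no restriction: Q may be replaced by the
  -- image of g, that is, by a total preorder on the carrier of P.
  ChainGapProperty : (a : Level) → Set (suc (c ⊔ ℓ₁ ⊔ ℓ₂ ⊔ a))
  ChainGapProperty a =
    ∀ (A B : Pred Carrier a) → Gap A B →
      Σ[ Q ∈ TotalOrder c ℓ₁ ℓ₂ ] Σ[ g ∈ PosetHomomorphism P (TotalOrder.poset Q) ]
        PreservesGap Q g A B

{-# OPTIONS --safe #-}
module Submission where

-- No selection: enlarging the lower-bounding set B moves a pair up in the order of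
-- pregaps, so a selection φ satisfies φ (A , ∅) ≤ φ (A , { u }) ≤ u for all upper
-- bounds u of A, that is, φ (A , ∅) = sup A.  Take points u₀ > v₀ > u₁ > v₁ > … of the
-- real line that increase for ≤ω₁, and A = { ↓ uₙ }.  Every element of L above A
-- contains almost all vₖ, but for every k some upper bound of A omits vₖ: the union of
-- ↓ u₀ , … , ↓ uₖ and ↓ r with uₖ₊₁ < r < vₖ and r late in the order ≤ω₁.
--
-- Chain-gap: let (A , B) be a gap, and call C covered if C ⊆ U ⊆ ⋂B for some U in L.
-- If ⋃A is covered below every β for ≤ω₁, then ⋃A is unbounded for ≤ω₁ and the bounds
-- for ≤ω₁ of the elements of L preserve the gap.  Otherwise let κ be the least place
-- below which ⋃A is not covered.  Choose sᵢ ∈ ⋃A converging to κ for ≤ω₁ such that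
-- every x that is above infinitely many sᵢ is above all of ⋃A ∩ ]γ , κ[ for some γ ≺ κ;
-- let α be the ≤ω₁-least such x, and let wᵢ be coinitial for ≤ᴿ in the countable
-- set { w ≤ω₁ α : w ∉ ⋂B }.  An element of L containing infinitely many sᵢ then
-- contains almost all wᵢ, so membership of the sᵢ and of the wᵢ ranks L in ω + ω*.

open import Defs
open import Axiom.DoubleNegationElimination using (em⇒dne)
open import Axiom.ExcludedMiddle using (ExcludedMiddle)
open import Data.Empty using (⊥; ⊥-elim)
open import Data.Nat.Base using (ℕ; zero; _+_; _*_; _⊔_; z≤n)
  renaming (suc to 1+_; _≤_ to _≤ⁿ_; _<_ to _<ⁿ_)
open import Data.Nat.Induction using () renaming (<-wellFounded to <ⁿ-wellFounded)
import Data.Nat.Properties as ℕ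
open import Data.Product.Base using (Σ-syntax; ∃; _×_; _,_; proj₁; proj₂; map; map₂)
import Data.Rational.Properties as ℚ
open import Data.Sum.Base using (_⊎_; inj₁; inj₂; [_,_]′) renaming (map to ⊎-map)
open import Function.Base using (_∘_; id; case_of_)
open import Function.Bundles using (Injection)
open import Function.Construct.Composition using () renaming (injection to _⟫_)
open import Induction.WellFounded using (WellFounded; Acc; acc)
open import Level using (Level; 0ℓ; suc; Lift; lift; lower) renaming (_⊔_ to _⊔ˡ_)
open import Relation.Binary.Bundles using (Setoid; Poset; TotalOrder)
open import Relation.Binary.Construct.Flip.EqAndOrd using ()
  renaming (isTotalOrder to flip-isTotalOrder)
open import Relation.Binary.Construct.NonStrictToStrict using ()
  renaming (_<_ to Strict; ≮⇒≥ to ≮⇒≥′; ≰⇒> to ≰⇒>′)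
open import Relation.Binary.Core using (Rel)
open import Relation.Binary.Definitions using (Total; tri<; tri≈; tri>)
open import Relation.Binary.Morphism.Bundles using (PosetHomomorphism; mkPosetHomo)
open import Relation.Binary.PropositionalEquality using (_≡_; refl; sym; trans; cong)
open import Relation.Binary.Structures using (IsPartialOrder; IsTotalOrder)
open import Relation.Nullary.Decidable using (yes; no; map′)
open import Relation.Nullary.Negation using (¬_)
open import Relation.Unary using (Pred; _∈_; _∉_; _⊆_; _∩_; _∪_; Satisfiable)

private
  variable
    a c p q r ℓ : Level

-- Classical logic and minimal elements

em-lower : ExcludedMiddle (suc 0ℓ) → ExcludedMiddle 0ℓ
em-lower em = map′ lower lift em

¬∀⇒∃¬ : {A : Set a} {P : Pred A p} → ExcludedMiddle (a ⊔ˡ p) → ExcludedMiddle p →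
        ¬ (∀ x → P x) → ∃ λ x → ¬ P x
¬∀⇒∃¬ em emₚ ¬∀ = em⇒dne em λ ¬∃ → ¬∀ λ x → em⇒dne emₚ λ ¬Px → ¬∃ (x , ¬Px)

minimal : {A : Set a} {_<_ : Rel A r} → ExcludedMiddle (a ⊔ˡ p ⊔ˡ r) → WellFounded _<_ →
          {P : Pred A p} → Satisfiable P → ∃ λ m → P m × (∀ y → P y → ¬ y < m)
minimal {_<_ = _<_} em wf {P} (x , Px) = go x Px (wf x)
  where
  go : ∀ x → P x → Acc _<_ x → ∃ λ m → P m × (∀ y → P y → ¬ y < m)
  go x Px (acc rs) with em {P = ∃ λ y → P y × y < x}
  ... | yes (y , Py , y<x) = go y Py (rs y<x)
  ... | no  ¬∃             = x , Px , λ y Py y<x → ¬∃ (y , Py , y<x)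

-- Cofinite and infinite sets of indices

Eventually Frequently : Pred ℕ p → Set p
Eventually P = ∃ λ k → ∀ i → k ≤ⁿ i → P i
Frequently P = ∀ k → ∃ λ i → k ≤ⁿ i × P i

frequently-map : {P : Pred ℕ p} {Q : Pred ℕ q} → P ⊆ Q → Frequently P → Frequently Q
frequently-map P⊆Q freq k = map₂ (map₂ P⊆Q) (freq k)

eventually-map : {P : Pred ℕ p} {Q : Pred ℕ q} → P ⊆ Q → Eventually P → Eventually Q
eventually-map P⊆Q = map₂ λ ev i k≤i → P⊆Q (ev i k≤i)

eventually-∩ : {P : Pred ℕ p} {Q : Pred ℕ q} → Eventually P → Eventually Q → Eventually (P ∩ Q)
eventually-∩ (k , P) (l , Q) = k ⊔ l , λ i k⊔l≤i →
  P i (ℕ.≤-trans (ℕ.m≤m⊔n k l) k⊔l≤i) , Q i (ℕ.≤-trans (ℕ.m≤n⊔m k l) k⊔l≤i)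

frequently-∩-eventually : {P : Pred ℕ p} {Q : Pred ℕ q} →
                          Frequently P → Eventually Q → ∃ λ i → P i × Q i
frequently-∩-eventually freq (k , Q) = let i , k≤i , Pi = freq k in i , Pi , Q i k≤i

¬frequently⇒eventually¬ : ExcludedMiddle p → {P : Pred ℕ p} →
                          ¬ Frequently P → Eventually (λ i → ¬ P i)
¬frequently⇒eventually¬ em ¬freq with ¬∀⇒∃¬ em em ¬freq
... | k , ¬∃ = k , λ i k≤i Pi → ¬∃ (i , k≤i , Pi)

frequently-∪ : ExcludedMiddle p → {P Q : Pred ℕ p} →
               Frequently (P ∪ Q) → Frequently P ⊎ Frequently Q
frequently-∪ em {P} {Q} freq with em {P = Frequently P}
... | yes P∞ = inj₁ P∞
... | no ¬P∞ with ¬frequently⇒eventually¬ em ¬P∞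
...   | k , ¬P = inj₂ λ l → case freq (k ⊔ l) of λ where
  (i , k⊔l≤i , inj₁ Pi) → ⊥-elim (¬P i (ℕ.≤-trans (ℕ.m≤m⊔n k l) k⊔l≤i) Pi)
  (i , k⊔l≤i , inj₂ Qi) → i , ℕ.≤-trans (ℕ.m≤n⊔m k l) k⊔l≤i , Qi

-- Countable sets

-- With `s = m + n` and `m ≤ s`, the value lies between `s * s` and `(1+ s) * (1+ s)`, the latter
-- excluded. These blocks are disjoint, so the value determines first `s` and then `m`.
pair : ℕ → ℕ → ℕ
pair m n = (m + n) * (m + n) + m

pair-sum : ∀ {m n m′ n′} → pair m n ≡ pair m′ n′ → ¬ m + n <ⁿ m′ + n′
pair-sum {m} {n} {m′} {n′} eq s<s′ = ℕ.<-irrefl eq (begin-strict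
  s * s + m           ≤⟨ ℕ.+-monoʳ-≤ (s * s) (ℕ.m≤m+n m n) ⟩
  s * s + s           ≡⟨ ℕ.+-comm (s * s) s ⟩
  (1+ s) * s           <⟨ ℕ.*-monoʳ-< (1+ s) (ℕ.n<1+n s) ⟩
  (1+ s) * (1+ s)       ≤⟨ ℕ.*-mono-≤ s<s′ s<s′ ⟩
  (m′ + n′) * (m′ + n′)      ≤⟨ ℕ.m≤m+n _ m′ ⟩
  (m′ + n′) * (m′ + n′) + m′ ∎)
  where
  open ℕ.≤-Reasoning
  s = m + n

pair-injective : ∀ m n m′ n′ → pair m n ≡ pair m′ n′ → m ≡ m′ × n ≡ n′
pair-injective m n m′ n′ eq = m≡m′ , n≡n′
  where
  s≡s′ : m + n ≡ m′ + n′
  s≡s′ = ℕ.≤-antisym (ℕ.≮⇒≥ (pair-sum {m′} {n′} {m} {n} (sym eq)))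
                     (ℕ.≮⇒≥ (pair-sum {m} {n} {m′} {n′} eq))
  m≡m′ : m ≡ m′
  m≡m′ = ℕ.+-cancelˡ-≡ ((m + n) * (m + n)) m m′ (trans eq (cong (λ s → s * s + m′) (sym s≡s′)))
  n≡n′ : n ≡ n′
  n≡n′ = ℕ.+-cancelˡ-≡ m n n′ (trans s≡s′ (cong (_+ n′) (sym m≡m′)))

module _ {X : Setoid c ℓ} where
  open Setoid X using (Carrier; _≈_)

  subsetoid-⊆ : {P : Pred Carrier p} {Q : Pred Carrier q} → P ⊆ Q →
                Injection (subsetoid X P) (subsetoid X Q)
  subsetoid-⊆ P⊆Q = record { to = map₂ P⊆Q ; cong = id ; injective = id }

  -- Running maxima along the enumeration: term `n` is above every element of code less than `n`.
  -- The total order is arbitrary, as `≤ω`, `≤ᴿ` and the reverse of `≤ᴿ` all occur.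
  cofinal-sequence : ExcludedMiddle (c ⊔ˡ p ⊔ˡ r) → ExcludedMiddle r → {_⊴_ : Rel Carrier r} →
    IsTotalOrder _≈_ _⊴_ → {C : Pred Carrier p} → Countable (subsetoid X C) → Satisfiable C →
    ∃ λ s → (∀ n → C (s n)) × (∀ {x} → C x → Eventually (λ n → x ⊴ s n))
  cofinal-sequence em emᵣ {_⊴_} isTO {C} e (x₀ , Cx₀) =
    proj₁ ∘ bound , proj₁ ∘ proj₂ ∘ bound ,
    λ {x} Cx → 1+ code (x , Cx) , λ n x<n → proj₂ (proj₂ (bound n)) (x , Cx) x<n
    where
    module T = IsTotalOrder isTO
    open Injection e using (injective) renaming (to to code)

    bound : ∀ n → ∃ λ s → C s × (∀ x → code x <ⁿ n → proj₁ x ⊴ s)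
    bound zero    = x₀ , Cx₀ , λ _ ()
    bound (1+ n) with bound n
    ... | s , Cs , ub with em {P = ∃ λ x → code x ≡ n × ¬ proj₁ x ⊴ s}
    ...   | no ¬∃ = s , Cs , λ x x<1+n → [ ub x , (λ x≡n → em⇒dne emᵣ λ x⋬s → ¬∃ (x , x≡n , x⋬s)) ]′
                                         (ℕ.m≤n⇒m<n∨m≡n (ℕ.≤-pred x<1+n))
    ...   | yes ((x , Cx) , x≡n , x⋬s) = x , Cx , λ y y<1+n →
      [ (λ y<n → T.trans (ub y y<n) s⊴x)
      , (λ y≡n → T.reflexive (injective (trans y≡n (sym x≡n))))
      ]′ (ℕ.m≤n⇒m<n∨m≡n (ℕ.≤-pred y<1+n))
      where
      s⊴x : s ⊴ x
      s⊴x = [ (λ x⊴s → ⊥-elim (x⋬s x⊴s)) , id ]′ (T.total x s)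

-- Gaps preserved by total preorders

module _ (em : ExcludedMiddle ℓ) {P : Poset ℓ ℓ ℓ} where
  open Poset P

  -- `Q` compares points by the sets `O i` that contain them. A set containing `x` but not `a` shows
  -- that `x` is not above `a`; one containing `b` but not `x` shows that `x` is not below `b`.
  chain-of-downsets : {I : Set ℓ} (O : I → Pred Carrier ℓ) →
    (∀ i {x y} → x ≤ y → y ∈ O i → x ∈ O i) →
    (∀ i j → O i ⊆ O j ⊎ O j ⊆ O i) →
    {A B : Pred Carrier ℓ} → Gaps.Gap P A B →
    (∀ x → (∃ λ i → x ∈ O i × ∃ λ a → a ∈ A × a ∉ O i) ⊎
           (∃ λ i → x ∉ O i × ∃ λ b → b ∈ B × b ∈ O i)) →
    Σ[ Q ∈ TotalOrder ℓ ℓ ℓ ] Σ[ g ∈ PosetHomomorphism P (TotalOrder.poset Q) ]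
      PreservesGap P Q g A B
  chain-of-downsets {I} O down linear {A} {B} (pregap , _) separates = Q , g , pregap′ , gap′
    where
    _⊴_ : Rel Carrier ℓ
    x ⊴ y = ∀ i → y ∈ O i → x ∈ O i

    ⊴-total : Total _⊴_
    ⊴-total x y with em {P = ∃ λ i → y ∈ O i × x ∉ O i}
    ... | no ¬∃ = inj₁ λ i y∈ → em⇒dne em λ x∉ → ¬∃ (i , y∈ , x∉)
    ... | yes (i , y∈ , x∉) = inj₂ λ j x∈ →
      [ (λ Oi⊆Oj → Oi⊆Oj y∈) , (λ Oj⊆Oi → ⊥-elim (x∉ (Oj⊆Oi x∈))) ]′ (linear i j)

    Q : TotalOrder ℓ ℓ ℓ
    Q = record
      { _≈_ = λ x y → x ⊴ y × y ⊴ x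
      ; _≤_ = _⊴_
      ; isTotalOrder = record
        { isPartialOrder = record
          { isPreorder = record
            { isEquivalence = record
              { refl  = (λ _ → id) , (λ _ → id)
              ; sym   = λ (x⊴y , y⊴x) → y⊴x , x⊴y
              ; trans = λ (x⊴y , y⊴x) (y⊴z , z⊴y) → (λ i → x⊴y i ∘ y⊴z i) , (λ i → z⊴y i ∘ y⊴x i)
              }
            ; reflexive = proj₁
            ; trans     = λ x⊴y y⊴z i → x⊴y i ∘ y⊴z i
            }
          ; antisym = _,_
          }
        ; total = ⊴-total
        }
      }

    g : PosetHomomorphism P (TotalOrder.poset Q)
    g = mkPosetHomo P (TotalOrder.poset Q) id (λ x≤y i → down i x≤y)

    pregap′ : Gaps.Pregap (TotalOrder.poset Q) (image P Q id A) (image P Q id B)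
    pregap′ (a , a∈A , _ , u⊴a) v (b , b∈B , b⊴v , _) i v∈ = u⊴a i (down i (pregap a∈A b b∈B) (b⊴v i v∈))

    gap′ : ¬ Gaps.Separable (TotalOrder.poset Q) (image P Q id A) (image P Q id B)
    gap′ (x , A⊴x , x⊴B) with separates x
    ... | inj₁ (i , x∈ , a , a∈A , a∉) = a∉ (A⊴x a (a , a∈A , (λ _ → id) , (λ _ → id)) i x∈)
    ... | inj₂ (i , x∉ , b , b∈B , b∈) = x∉ (x⊴B b (b , b∈B , (λ _ → id) , (λ _ → id)) i b∈)

  -- The chain is ω + ω*: the lower part ranks x by the least k with x ∈ D k and
  -- the upper part by the least k with x ∈ E k, whichever is smaller.
  interleave : (D E : ℕ → Pred Carrier ℓ) →
    (∀ k {x y} → x ≤ y → y ∈ D k → x ∈ D k) → (∀ k {x y} → x ≤ y → x ∈ E k → y ∈ E k) →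
    (∀ {k l} → k ≤ⁿ l → D k ⊆ D l) → (∀ {k l} → k ≤ⁿ l → E k ⊆ E l) →
    (∀ x → (∃ λ k → x ∈ D k) ⊎ (∃ λ k → x ∈ E k)) →
    {A B : Pred Carrier ℓ} → Gaps.Gap P A B →
    (∀ k → ∃ λ a → a ∈ A × a ∉ D k) → (∀ k → Satisfiable (E k) → ∃ λ b → b ∈ B × b ∉ E k) →
    Σ[ Q ∈ TotalOrder ℓ ℓ ℓ ] Σ[ g ∈ PosetHomomorphism P (TotalOrder.poset Q) ]
      PreservesGap P Q g A B
  interleave D E D-down E-up D-mono E-mono cover {A} {B} gap A⊈D B⊈E =
    chain-of-downsets {I = Lift ℓ (ℕ ⊎ ℕ)} (O ∘ lower) (down ∘ lower)
      (λ i j → linear (lower i) (lower j)) gap separates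
    where
    -- Ties go to `D`: `O (inj₁ k)` holds what enters `D` by stage `k` and enters `E` no sooner;
    -- `O (inj₂ k)` leaves out what is in `E` but not in `D` at some stage up to `k`.
    O : ℕ ⊎ ℕ → Pred Carrier ℓ
    O (inj₁ k) x = ∃ λ j → j ≤ⁿ k × x ∈ D j × (∀ i → i <ⁿ j → x ∉ E i)
    O (inj₂ k) x = ∀ j → j ≤ⁿ k → x ∈ E j → x ∈ D j

    down : ∀ i {x y} → x ≤ y → y ∈ O i → x ∈ O i
    down (inj₁ k) x≤y (j , j≤k , y∈D , y∉E) =
      j , j≤k , D-down j x≤y y∈D , λ i i<j x∈E → y∉E i i<j (E-up i x≤y x∈E)
    down (inj₂ k) x≤y y∈O j j≤k x∈E = D-down j x≤y (y∈O j j≤k (E-up j x≤y x∈E))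

    low⊆high : ∀ k l → O (inj₁ k) ⊆ O (inj₂ l)
    low⊆high k l (j , _ , x∈D , x∉E) i _ x∈E = D-mono (ℕ.≮⇒≥ λ i<j → x∉E i i<j x∈E) x∈D

    linear : ∀ i j → O i ⊆ O j ⊎ O j ⊆ O i
    linear (inj₁ k) (inj₁ l) = ⊎-map (λ k≤l → map₂ λ (j≤k , r) → ℕ.≤-trans j≤k k≤l , r)
                                     (λ l≤k → map₂ λ (j≤l , r) → ℕ.≤-trans j≤l l≤k , r) (ℕ.≤-total k l)
    linear (inj₁ k) (inj₂ l) = inj₁ (low⊆high k l)
    linear (inj₂ k) (inj₁ l) = inj₂ (low⊆high l k)
    linear (inj₂ k) (inj₂ l) = ⊎-map (λ l≤k x∈ j j≤l → x∈ j (ℕ.≤-trans j≤l l≤k))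
                                     (λ k≤l x∈ j j≤k → x∈ j (ℕ.≤-trans j≤k k≤l)) (ℕ.≤-total l k)

    A⊈low : ∀ k → ∃ λ a → a ∈ A × a ∉ O (inj₁ k)
    A⊈low k = map₂ (map₂ λ a∉D (j , j≤k , a∈D , _) → a∉D (D-mono j≤k a∈D)) (A⊈D k)

    B∩high : ∀ k {x} → x ∈ E k → ∃ λ b → b ∈ B × b ∈ O (inj₂ k)
    B∩high k x∈E = map₂ (map₂ λ b∉E j j≤k b∈E → ⊥-elim (b∉E (E-mono j≤k b∈E))) (B⊈E k (_ , x∈E))

    separates : ∀ x → (∃ λ i → x ∈ O (lower i) × ∃ λ a → a ∈ A × a ∉ O (lower i)) ⊎
                      (∃ λ i → x ∉ O (lower i) × ∃ λ b → b ∈ B × b ∈ O (lower i))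
    separates x with em {P = ∃ λ k → x ∈ O (inj₁ k)}
    ... | yes (k , x∈) = inj₁ (lift (inj₁ k) , x∈ , A⊈low k)
    ... | no ¬low = inj₂ (above first)
      where
      -- Otherwise `x` is in `D i` whenever it is in `E i`. Then no `E i` contains `x` before the
      -- first `D m` does, which puts `x` into `O (inj₁ m)`.
      first : ∃ λ k → x ∈ E k × x ∉ D k
      first = em⇒dne em λ ¬∃ →
        let x∈D = [ id , (λ (k , x∈E) → k , em⇒dne em λ x∉D → ¬∃ (k , x∈E , x∉D)) ]′ (cover x)
            m , x∈Dm , least = minimal em <ⁿ-wellFounded x∈D
        in ¬low (m , m , ℕ.≤-refl , x∈Dm , λ i i<m x∈E → ¬∃ (i , x∈E , λ x∈Di → least i x∈Di i<m))

      above : (∃ λ k → x ∈ E k × x ∉ D k) → _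
      above (k , x∈E , x∉D) = lift (inj₂ k) , (λ x∈O → x∉D (x∈O k ℕ.≤-refl x∈E)) , B∩high k x∈E

-- The lattice of an intersection of two total orders

module _ (em : ExcludedMiddle (suc 0ℓ)) (X : Setoid (suc 0ℓ) 0ℓ)
  {_≤ω_ _≤ᴿ_ : Rel (Setoid.Carrier X) 0ℓ}
  (hω : HasOrderTypeω₁ X _≤ω_) (≤ᴿ-isTotalOrder : IsTotalOrder (Setoid._≈_ X) _≤ᴿ_)
  (≤-isPartialOrder : IsPartialOrder (Setoid._≈_ X) (λ x y → x ≤ω y × x ≤ᴿ y))
  where

  open Setoid X using (Carrier; _≈_)

  private
    em₀ : ExcludedMiddle 0ℓ
    em₀ = em-lower em

    P : Poset (suc 0ℓ) 0ℓ 0ℓ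
    P = record { isPartialOrder = ≤-isPartialOrder }

    module Lat = Poset (L P)
    module X = Setoid X
    open HasOrderTypeω₁ hω
    module Ω = IsTotalOrder isTotalOrder
    module R = IsTotalOrder ≤ᴿ-isTotalOrder
    open Poset P using (_≤_) renaming (refl to ≤-refl; trans to ≤-trans; reflexive to ≤-reflexive)

    infix 4 _≺_ _<ᴿ_
    _≺_ _<ᴿ_ : Rel Carrier 0ℓ
    _≺_  = Strict _≈_ _≤ω_
    _<ᴿ_ = Strict _≈_ _≤ᴿ_

    variable
      x y z : Carrier
      U V : Pred Carrier 0ℓ

  ⊀⇒≽ : ¬ x ≺ y → y ≤ω x
  ⊀⇒≽ = ≮⇒≥′ _≈_ _≤ω_ X.sym (λ _ _ → em₀) Ω.reflexive Ω.total

  ≤ω-≺-trans : x ≤ω y → y ≺ z → x ≺ z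
  ≤ω-≺-trans x≤y (y≤z , y≉z) = Ω.trans x≤y y≤z , λ x≈z →
    y≉z (Ω.antisym y≤z (Ω.trans (Ω.reflexive (X.sym x≈z)) x≤y))

  ω-least : {Q : Pred Carrier (suc 0ℓ)} → Satisfiable Q → ∃ λ m → Q m × (∀ x → Q x → m ≤ω x)
  ω-least sat = map₂ (map₂ λ least x Qx → ⊀⇒≽ (least x Qx)) (minimal em wellFounded sat)

  point : Carrier
  point with em {P = Carrier}
  ... | yes x = x
  ... | no ¬x = ⊥-elim (uncountable record
    { to = ⊥-elim ∘ ¬x ; cong = λ {x} → ⊥-elim (¬x x) ; injective = λ {x} → ⊥-elim (¬x x) })

  generated-down : Generated P U → x ≤ y → y ∈ U → x ∈ U
  generated-down (gen _) x≤y y≤z = ≤-trans x≤y y≤z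
  generated-down (gU ∪ᴳ gV) x≤y = ⊎-map (generated-down gU x≤y) (generated-down gV x≤y)
  generated-down (gU ∩ᴳ gV) x≤y = map (generated-down gU x≤y) (generated-down gV x≤y)
  generated-down (resp (U⊆V , V⊆U) gU) x≤y y∈V = U⊆V (generated-down gU x≤y (V⊆U y∈V))

  generated-bounded : Generated P U → ∃ λ α → ∀ x → x ∈ U → x ≤ω α
  generated-bounded (gen x) = x , λ _ → proj₁
  generated-bounded (gU ∪ᴳ gV) with generated-bounded gU | generated-bounded gV
  ... | α , U≤α | β , V≤β with Ω.total α β
  ...   | inj₁ α≤β = β , λ x → [ (λ x∈U → Ω.trans (U≤α x x∈U) α≤β) , V≤β x ]′
  ...   | inj₂ β≤α = α , λ x → [ U≤α x , (λ x∈V → Ω.trans (V≤β x x∈V) β≤α) ]′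
  generated-bounded (gU ∩ᴳ gV) = map₂ (λ U≤α x → U≤α x ∘ proj₁) (generated-bounded gU)
  generated-bounded (resp (_ , V⊆U) gU) = map₂ (λ U≤α x → U≤α x ∘ V⊆U) (generated-bounded gU)

  -- Lying in a union infinitely often means doing so in one of the two parts; for an intersection
  -- it means doing so in both. Induction thus reduces the claim to principal sets.
  generated-filter : {s : ℕ → Carrier} (Φ : Pred (Pred Carrier 0ℓ) p) →
    (∀ {U V} → U ⊆ V → Φ U → Φ V) → (∀ {U V} → Φ U → Φ V → Φ (U ∩ V)) →
    (∀ x → Frequently (λ i → s i ≤ x) → Φ (↓ P x)) →
    Generated P U → Frequently (λ i → s i ∈ U) → Φ U
  generated-filter {s = s} Φ mono meet base = go
    where
    go : Generated P U → Frequently (λ i → s i ∈ U) → Φ U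
    go (gen x) freq = base x freq
    go (gU ∪ᴳ gV) freq = [ mono inj₁ ∘ go gU , mono inj₂ ∘ go gV ]′ (frequently-∪ em₀ freq)
    go (gU ∩ᴳ gV) freq = meet (go gU (frequently-map proj₁ freq)) (go gV (frequently-map proj₂ freq))
    go (resp (U⊆V , V⊆U) gU) freq = mono U⊆V (go gU (frequently-map V⊆U freq))

  generated-eventually : {s t : ℕ → Carrier} →
    (∀ x → Frequently (λ i → s i ≤ x) → Eventually (λ i → t i ≤ x)) →
    Generated P U → Frequently (λ i → s i ∈ U) → Eventually (λ i → t i ∈ U)
  generated-eventually {t = t} = generated-filter (λ U → Eventually (λ i → t i ∈ U))
    (λ U⊆V → eventually-map U⊆V) eventually-∩

  -- The chain-gap property

  module _ (step : ∀ y → ∃ λ z → z <ᴿ y × y ≤ω z) where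

    beyond : ∀ α → ∃ λ β → α ≺ β
    beyond α with step α
    ... | β , (_ , β≉α) , α≤β = β , α≤β , β≉α ∘ X.sym

    empty-generated : ∃ λ U → Generated P U × (∀ x → x ∉ U)
    empty-generated with ω-least {Q = λ _ → Lift _ ℕ} (point , lift 0)
    ... | m , _ , least with step m
    ...   | r , (r≤m , r≉m) , _ = ↓ P m ∩ ↓ P r , gen m ∩ᴳ gen r , λ x ((x≤m , _) , (_ , x≤r)) →
      r≉m (R.antisym r≤m (R.trans (R.reflexive (Ω.antisym (least x (lift 0)) x≤m)) x≤r))

    module _ {A B : Pred Lat.Carrier (suc 0ℓ)} (gap : Gaps.Gap (L P) A B) where

      ⋃A ⋂B : Pred Carrier (suc 0ℓ)
      ⋃A x = ∃ λ U → U ∈ A × x ∈ proj₁ U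
      ⋂B x = ∀ U → U ∈ B → x ∈ proj₁ U

      Covered : Pred Carrier (suc 0ℓ) → Set (suc 0ℓ)
      Covered C = ∃ λ U → Generated P U × C ⊆ U × U ⊆ ⋂B

      Preserved : Set _
      Preserved = Σ[ Q ∈ TotalOrder (suc 0ℓ) (suc 0ℓ) (suc 0ℓ) ]
                  Σ[ g ∈ PosetHomomorphism (L P) (TotalOrder.poset Q) ] PreservesGap (L P) Q g A B

      covered-⊆ : ∀ {C D} → C ⊆ D → Covered D → Covered C
      covered-⊆ C⊆D (U , gU , D⊆U , U⊆B) = U , gU , (λ x∈C → D⊆U (C⊆D x∈C)) , U⊆B

      covered-∪ : ∀ {C D} → Covered C → Covered D → Covered (C ∪ D)
      covered-∪ (U , gU , C⊆U , U⊆B) (V , gV , D⊆V , V⊆B) =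
        U ∪ V , gU ∪ᴳ gV , ⊎-map C⊆U D⊆V , [ U⊆B , V⊆B ]′

      covered-∅ : ∀ {C} → (∀ x → x ∉ C) → Covered C
      covered-∅ C≡∅ with empty-generated
      ... | U , gU , U≡∅ = U , gU , (λ x∈C → ⊥-elim (C≡∅ _ x∈C)) , (λ x∈U → ⊥-elim (U≡∅ _ x∈U))

      ¬covered-⋃A : ¬ Covered ⋃A
      ¬covered-⋃A (U , gU , A⊆U , U⊆B) =
        proj₂ gap ((U , gU) , (λ V V∈A x∈V → A⊆U (V , V∈A , x∈V)) , (λ V V∈B x∈U → U⊆B x∈U V V∈B))

      covered-≈ : ∀ γ → Covered (⋃A ∩ (_≈ γ))
      covered-≈ γ with em {P = γ ∈ ⋃A}
      ... | yes ((U , gU) , U∈A , γ∈U) =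
        U , gU , (λ (_ , u≈γ) → generated-down gU (≤-reflexive u≈γ) γ∈U) ,
        λ x∈U V V∈B → proj₁ gap U∈A V V∈B x∈U
      ... | no γ∉A = covered-∅ λ u (((U , gU) , U∈A , u∈U) , u≈γ) →
        γ∉A ((U , gU) , U∈A , generated-down gU (≤-reflexive (X.sym u≈γ)) u∈U)

      preserved-unbounded : (∀ β → Covered (⋃A ∩ (_≺ β))) → Preserved
      preserved-unbounded covered = chain-of-downsets em
        (λ α V → ∀ x → x ∈ proj₁ V → x ≤ω α)
        (λ α V⊆W W≤α x x∈V → W≤α x (V⊆W x∈V))
        (λ α β → ⊎-map (λ α≤β V≤α x x∈V → Ω.trans (V≤α x x∈V) α≤β)
                       (λ β≤α V≤β x x∈V → Ω.trans (V≤β x x∈V) β≤α) (Ω.total α β))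
        gap
        λ (V , gV) → let α , V≤α = generated-bounded gV in inj₁ (α , V≤α , exceeds α)
        where
        -- If `α` bounded all elements of `A`, then `⋃A` would lie strictly before a later point and
        -- be covered, which would separate the gap.
        exceeds : ∀ α → ∃ λ U → U ∈ A × ¬ (∀ x → x ∈ proj₁ U → x ≤ω α)
        exceeds α = em⇒dne em λ ¬∃ → ¬covered-⋃A (covered-⊆
          (λ {x} (U , U∈A , x∈U) → (U , U∈A , x∈U) ,
            ≤ω-≺-trans (em⇒dne em₀ λ x≰α → ¬∃ (U , U∈A , λ U≤α → x≰α (U≤α x x∈U))) (proj₂ (beyond α)))
          (covered (proj₁ (beyond α))))

      -- `D k` collects the elements of the lattice that avoid `s` from index `k` on. One outside
      -- every `D k` contains infinitely many `s i` and so falls into some `E k`.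
      preserved-by-sequences : (s : ℕ → Carrier) → (∀ i → s i ∈ ⋃A) →
        (E : ℕ → Pred Lat.Carrier (suc 0ℓ)) →
        (∀ k {V W} → V Lat.≤ W → V ∈ E k → W ∈ E k) → (∀ {k l} → k ≤ⁿ l → E k ⊆ E l) →
        (∀ k → Satisfiable (E k) → ∃ λ V → V ∈ B × V ∉ E k) →
        (∀ V → Frequently (λ i → s i ∈ proj₁ V) → ∃ λ k → V ∈ E k) → Preserved
      preserved-by-sequences s s∈A E E-up E-mono B⊈E freq⇒E = interleave em
        D E
        (λ k V⊆W (lift avoids) → lift λ i k≤i s∈V → avoids i k≤i (V⊆W s∈V)) E-up
        (λ k≤l (lift avoids) → lift λ i l≤i → avoids i (ℕ.≤-trans k≤l l≤i)) E-mono
        cover gap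
        (λ k → let U , U∈A , s∈U = s∈A k in U , U∈A , λ (lift avoids) → avoids k ℕ.≤-refl s∈U) B⊈E
        where
        D : ℕ → Pred Lat.Carrier (suc 0ℓ)
        D k V = Lift _ (∀ i → k ≤ⁿ i → s i ∉ proj₁ V)

        cover : ∀ V → (∃ λ k → V ∈ D k) ⊎ (∃ λ k → V ∈ E k)
        cover V with em₀ {P = Frequently (λ i → s i ∈ proj₁ V)}
        ... | yes freq = inj₂ (freq⇒E V freq)
        ... | no ¬freq = inj₁ (map₂ lift (¬frequently⇒eventually¬ em₀ ¬freq))

      -- The least uncovered place

      module _ (κ : Carrier) (¬covered : ¬ Covered (⋃A ∩ (_≺ κ)))
               (covered : ∀ γ → γ ≺ κ → Covered (⋃A ∩ (_≺ γ))) where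

        K : Pred Carrier (suc 0ℓ)
        K = ⋃A ∩ (_≺ κ)

        Tail : Carrier → Pred Carrier (suc 0ℓ)
        Tail γ u = K u × γ ≺ u

        -- The part of `K` before `γ` is covered, and so is the point `γ`; a cover of the tail would
        -- complete a cover of `K`.
        ¬covered-tail : ∀ γ → γ ≺ κ → ¬ Covered (Tail γ)
        ¬covered-tail γ γ≺κ c =
          ¬covered (covered-⊆ split (covered-∪ (covered γ γ≺κ) (covered-∪ (covered-≈ γ) c)))
          where
          split : K ⊆ (⋃A ∩ (_≺ γ)) ∪ ((⋃A ∩ (_≈ γ)) ∪ Tail γ)
          split {u} u∈K with em₀ {P = u ≈ γ} | Ω.total u γ
          ... | yes u≈γ | _        = inj₂ (inj₁ (proj₁ u∈K , u≈γ))
          ... | no  u≉γ | inj₁ u≤γ = inj₁ (proj₁ u∈K , u≤γ , u≉γ)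
          ... | no  u≉γ | inj₂ γ≤u = inj₂ (inj₂ (u∈K , γ≤u , u≉γ ∘ X.sym))

        K-countable : Countable (subsetoid X K)
        K-countable = subsetoid-⊆ {X = X} proj₂ ⟫ segmentCountable κ

        K-satisfiable : Satisfiable K
        K-satisfiable = em⇒dne em λ ¬∃ → ¬covered (covered-∅ λ x x∈K → ¬∃ (x , x∈K))

        Dominates : Carrier → Pred Carrier (suc 0ℓ)
        Dominates x γ = γ ≺ κ × (∀ u → Tail γ u → u ≤ᴿ x)

        γs : ∃ λ s → (∀ n → K (s n)) × (∀ {x} → K x → Eventually (λ n → x ≤ω s n))
        γs = cofinal-sequence {X = X} em em₀ isTotalOrder K-countable K-satisfiable

        γ : ℕ → Carrier
        γ = proj₁ γs

        γ≺κ : ∀ i → γ i ≺ κ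
        γ≺κ i = proj₂ (proj₁ (proj₂ γs) i)

        limsup-sequence : ∃ λ s → (∀ i → Tail (γ i) (s i)) ×
          (∀ x → Frequently (λ i → s i ≤ᴿ x) → ∃ (Dominates x))
        limsup-sequence with em {P = ∃ λ γ₀ → γ₀ ≺ κ × (∀ u → Tail γ₀ u → ¬ ∃ (Dominates u))}
        -- Points dominating a tail occur arbitrarily late. With such points as the `s i`, a single
        -- `s i ≤ᴿ x` suffices.
        ... | no ¬∃ = proj₁ ∘ choose , proj₁ ∘ proj₂ ∘ choose , λ x freq →
            let i , _ , s≤x = freq 0
            in map₂ (map₂ λ tail≤s u u∈T → R.trans (tail≤s u u∈T) s≤x) (proj₂ (proj₂ (choose i)))
          where
          choose : ∀ i → ∃ λ u → Tail (γ i) u × ∃ (Dominates u)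
          choose i = em⇒dne em λ ¬u → ¬∃ (γ i , γ≺κ i , λ u u∈T dom → ¬u (u , u∈T , dom))
        -- After `γ₀` no point dominates a tail. So each term `t i` of a sequence cofinal in
        -- `Tail γ₀` for `≤ᴿ` is exceeded by some point beyond `γ i`, taken as `s i`. An `x` above
        -- infinitely many `s i` is then above all of `Tail γ₀`.
        ... | yes (γ₀ , γ₀≺κ , none)
            with cofinal-sequence {X = X} em em₀ ≤ᴿ-isTotalOrder {C = Tail γ₀}
                   (subsetoid-⊆ {X = X} proj₁ ⟫ K-countable)
                   (em⇒dne em λ ¬∃ → ¬covered-tail γ₀ γ₀≺κ (covered-∅ λ x x∈T → ¬∃ (x , x∈T)))
        ...   | t , t∈T , t-cofinal = proj₁ ∘ choose , proj₁ ∘ proj₂ ∘ choose , λ x freq →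
            γ₀ , γ₀≺κ , λ u u∈T → let i , s≤x , u≤t = frequently-∩-eventually freq (t-cofinal u∈T)
                                   in R.trans u≤t (R.trans (proj₂ (proj₂ (choose i))) s≤x)
          where
          choose : ∀ i → ∃ λ u → Tail (γ i) u × t i ≤ᴿ u
          choose i = em⇒dne em λ ¬u → none (t i) (t∈T i) (γ i , γ≺κ i , λ u u∈T →
            [ id , (λ t≤u → ⊥-elim (¬u (u , u∈T , t≤u))) ]′ (R.total u (t i)))

        s : ℕ → Carrier
        s = proj₁ limsup-sequence

        -- This adds the `≤ω` half: `s i` comes after `γ i`, and `γ` is cofinal in `K`, so `x`
        -- bounds all of `K`.
        frequently⇒tail : ∀ x → Frequently (λ i → s i ≤ x) → ∃ λ γ → γ ≺ κ × (∀ u → Tail γ u → u ≤ x)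
        frequently⇒tail x freq = map₂ (map₂ λ tail≤x u u∈T → K≤x (proj₁ u∈T) , tail≤x u u∈T)
          (proj₂ (proj₂ limsup-sequence) x (frequently-map proj₂ freq))
          where
          K≤x : ∀ {u} → K u → u ≤ω x
          K≤x u∈K = let i , (s≤x , _) , u≤γ = frequently-∩-eventually freq (proj₂ (proj₂ γs) u∈K)
                    in Ω.trans u≤γ (Ω.trans (proj₁ (proj₂ (proj₁ (proj₂ limsup-sequence) i))) s≤x)

        s∈A : ∀ i → s i ∈ ⋃A
        s∈A i = proj₁ (proj₁ (proj₁ (proj₂ limsup-sequence) i))

        -- Otherwise `↓ P x ∩ ↓ P y` would lie in `⋂B` and cover the tail after the later of `γ₁`
        -- and `γ₂`.
        escapes : ∀ x y → Frequently (λ i → s i ≤ x) → Frequently (λ i → s i ≤ y) →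
                  ∃ λ w → w ≤ x × w ≤ y × w ∉ ⋂B
        escapes x y fx fy with frequently⇒tail x fx | frequently⇒tail y fy
        ... | γ₁ , γ₁≺κ , T₁≤x | γ₂ , γ₂≺κ , T₂≤y = em⇒dne em λ ¬∃ →
            let sub : ∀ {w} → w ∈ ↓ P x ∩ ↓ P y → w ∈ ⋂B
                sub {w} (w≤x , w≤y) = em⇒dne em λ w∉B → ¬∃ (w , w≤x , w≤y , w∉B)
            in case Ω.total γ₁ γ₂ of λ where
              (inj₁ γ₁≤γ₂) → ¬covered-tail γ₂ γ₂≺κ (↓ P x ∩ ↓ P y , gen x ∩ᴳ gen y ,
                (λ {u} (u∈K , γ₂≺u) → T₁≤x u (u∈K , ≤ω-≺-trans γ₁≤γ₂ γ₂≺u) , T₂≤y u (u∈K , γ₂≺u)) , sub)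
              (inj₂ γ₂≤γ₁) → ¬covered-tail γ₁ γ₁≺κ (↓ P x ∩ ↓ P y , gen x ∩ᴳ gen y ,
                (λ {u} (u∈K , γ₁≺u) → T₁≤x u (u∈K , γ₁≺u) , T₂≤y u (u∈K , ≤ω-≺-trans γ₂≤γ₁ γ₁≺u)) , sub)

        module _ (α : Carrier) (α-freq : Frequently (λ i → s i ≤ α))
                 (α-least : ∀ x → Frequently (λ i → s i ≤ x) → α ≤ω x) where

          W : Pred Carrier (suc 0ℓ)
          W w = w ≤ω α × w ∉ ⋂B

          W-coinitial : ∃ λ w → (∀ n → W (w n)) × (∀ {x} → W x → Eventually (λ n → w n ≤ᴿ x))
          W-coinitial = cofinal-sequence {X = X} em em₀ (flip-isTotalOrder ≤ᴿ-isTotalOrder)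
            (subsetoid-⊆ {X = X} {P = W} (λ (w≤α , _) → ≤ω-≺-trans w≤α (proj₂ (beyond α)))
              ⟫ segmentCountable (proj₁ (beyond α)))
            (let w , (w≤α , _) , _ , w∉B = escapes α α α-freq α-freq in w , w≤α , w∉B)

          w : ℕ → Carrier
          w = proj₁ W-coinitial

          -- `escapes` gives a point `v` of `W` below both `α` and `x`. Almost all `w i` are `≤ᴿ v`,
          -- hence `≤ᴿ x`, and `w i ≤ω α ≤ω x` because `α` is least.
          frequently⇒eventually : ∀ x → Frequently (λ i → s i ≤ x) → Eventually (λ i → w i ≤ x)
          frequently⇒eventually x freq =
            let v , (v≤α , _) , (_ , v≤x) , v∉B = escapes α x α-freq freq
            in eventually-map
                 (λ {i} w≤v → Ω.trans (proj₁ (proj₁ (proj₂ W-coinitial) i)) (α-least x freq) , R.trans w≤v v≤x)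
                 (proj₂ (proj₂ W-coinitial) (v≤α , v∉B))

          preserved-attained : Preserved
          preserved-attained = preserved-by-sequences s s∈A
            (λ k V → Lift _ (∀ i → k ≤ⁿ i → w i ∈ proj₁ V))
            (λ k V⊆W (lift w∈V) → lift λ i k≤i → V⊆W (w∈V i k≤i))
            (λ k≤l (lift w∈V) → lift λ i l≤i → w∈V i (ℕ.≤-trans k≤l l≤i))
            (λ k _ → let V , ¬V = ¬∀⇒∃¬ em em (proj₂ (proj₁ (proj₂ W-coinitial) k))
                     in V , em⇒dne em (λ V∉B → ¬V λ V∈B → ⊥-elim (V∉B V∈B)) ,
                        λ (lift w∈V) → ¬V λ _ → w∈V k ℕ.≤-refl)
            λ (V , gV) freq → map₂ lift (generated-eventually frequently⇒eventually gV freq)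

        preserved-limit : Preserved
        preserved-limit with em {P = ∃ λ x → Lift (suc 0ℓ) (Frequently (λ i → s i ≤ x))}
        ... | yes sat = let α , lift α-freq , least = ω-least sat
                        in preserved-attained α α-freq λ x freq → least x (lift freq)
        -- No principal set contains infinitely many `s i`, hence no element of the lattice does,
        -- and the upper half of the chain is empty.
        ... | no ¬∃ = preserved-by-sequences s s∈A (λ _ _ → Lift _ ⊥)
          (λ _ _ ()) (λ _ ()) (λ { _ (_ , ()) })
          λ (V , gV) freq →
            ⊥-elim (generated-filter (λ _ → ⊥) (λ _ ()) (λ ()) (λ x fx → ¬∃ (x , lift fx)) gV freq)

      preserved : Preserved
      preserved with em {P = ∃ λ κ → ¬ Covered (⋃A ∩ (_≺ κ))}
      ... | no ¬∃ = preserved-unbounded λ β → em⇒dne em λ ¬c → ¬∃ (β , ¬c)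
      ... | yes sat with minimal em wellFounded sat
      ...   | κ , ¬c , least = preserved-limit κ ¬c λ γ γ≺κ → em⇒dne em λ ¬c′ → least γ ¬c′ γ≺κ

  -- Failure of the selection property

  -- Otherwise the countable segments before the `y n` would exhaust the chain, and a point could be
  -- coded by some `n` together with its code in that segment.
  ω-bounded : (y : ℕ → Carrier) → ∃ λ α → ∀ n → y n ≤ω α
  ω-bounded y = em⇒dne em λ ¬∃ →
    let unbounded : ∀ α → ∃ λ n → α ≺ y n
        unbounded α = let n , ¬y≤α = ¬∀⇒∃¬ em₀ em₀ (λ y≤α → ¬∃ (α , y≤α))
                      in n , ≰⇒>′ _≈_ _≤ω_ X.sym Ω.reflexive Ω.total ¬y≤α
        -- The least such `n` is the same for equal points, as `cong` demands.
        first : ∀ α → ∃ λ n → α ≺ y n × (∀ m → α ≺ y m → ¬ m <ⁿ n)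
        first α = minimal em₀ <ⁿ-wellFounded (unbounded α)
    in uncountable record
      { to = λ α → let n , α≺y , _ = first α in pair n (code n (α , α≺y))
      ; cong = λ {α} {β} α≈β →
          let m , α≺y , ¬<m = first α
              n , β≺y , ¬<n = first β
          in code-cong (ℕ.≤-antisym (ℕ.≮⇒≥ (¬<m n (≤ω-≺-trans (Ω.reflexive α≈β) β≺y)))
                                    (ℕ.≮⇒≥ (¬<n m (≤ω-≺-trans (Ω.reflexive (X.sym α≈β)) α≺y)))) α≺y β≺y α≈β
      ; injective = λ {α} {β} eq →
          let m , α≺y , _ = first α
              n , β≺y , _ = first β
              m≡n , code≡ = pair-injective m _ n _ eq
          in code-injective m≡n α≺y β≺y code≡
      }
    where
    code : ∀ n → (∃ λ α → α ≺ y n) → ℕ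
    code n = Injection.to (segmentCountable (y n))

    code-cong : ∀ {m n α β} → m ≡ n → (p : α ≺ y m) (q : β ≺ y n) → α ≈ β →
                pair m (code m (α , p)) ≡ pair n (code n (β , q))
    code-cong {m} refl p q α≈β = cong (pair m) (Injection.cong (segmentCountable (y m)) α≈β)

    code-injective : ∀ {m n α β} → m ≡ n → (p : α ≺ y m) (q : β ≺ y n) →
                     code m (α , p) ≡ code n (β , q) → α ≈ β
    code-injective {m} refl p q = Injection.injective (segmentCountable (y m))

  module _ {u v r : ℕ → Carrier} {α : Carrier}
           (v<u : ∀ n → v n <ᴿ u n) (u<v : ∀ n → u (1+ n) <ᴿ v n)
           (u≤ωv : ∀ n → u n ≤ω v n) (v≤ωu : ∀ n → v n ≤ω u (1+ n))
           (u≤ωα : ∀ n → u n ≤ω α) (α≤ωr : ∀ n → α ≤ω r n)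
           (u<r : ∀ n → u (1+ n) <ᴿ r n) (r<v : ∀ n → r n <ᴿ v n) where

    u-monotone : ∀ {m n} → m ≤ⁿ n → u m ≤ω u n × u n ≤ᴿ u m
    u-monotone {m} {zero} z≤n = Ω.refl , R.refl
    u-monotone {m} {1+ n} m≤1+n with ℕ.m≤n⇒m<n∨m≡n m≤1+n
    ... | inj₂ refl = Ω.refl , R.refl
    ... | inj₁ m<1+n = map (λ um≤un → Ω.trans um≤un (Ω.trans (u≤ωv n) (v≤ωu n)))
                           (λ un≤um → R.trans (R.trans (proj₁ (u<v n)) (proj₁ (v<u n))) un≤um)
                           (u-monotone (ℕ.≤-pred m<1+n))

    -- For `≤ω`, each `v i` is below all later `u l`, some of which are below `x`. For `≤ᴿ` the
    -- points descend, so one `u k ≤ᴿ x` puts every `v i` with `k ≤ i` below `x`.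
    u-frequently⇒v-eventually : ∀ x → Frequently (λ i → u i ≤ x) → Eventually (λ i → v i ≤ x)
    u-frequently⇒v-eventually x freq = let k , _ , _ , uk≤x = freq 0 in k , λ i k≤i →
      let l , i<l , ul≤x , _ = freq (1+ i)
      in Ω.trans (Ω.trans (v≤ωu i) (proj₁ (u-monotone i<l))) ul≤x ,
         R.trans (proj₁ (v<u i)) (R.trans (proj₂ (u-monotone k≤i)) uk≤x)

    initial : ℕ → Pred Carrier 0ℓ
    initial zero   = ↓ P (u zero)
    initial (1+ k) = initial k ∪ ↓ P (u (1+ k))

    initial-generated : ∀ k → Generated P (initial k)
    initial-generated zero   = gen _
    initial-generated (1+ k) = initial-generated k ∪ᴳ gen _

    initial-⊇ : ∀ k {j} → j ≤ⁿ k → ↓ P (u j) ⊆ initial k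
    initial-⊇ zero z≤n = id
    initial-⊇ (1+ k) j≤1+k with ℕ.m≤n⇒m<n∨m≡n j≤1+k
    ... | inj₁ j<1+k = inj₁ ∘ initial-⊇ k (ℕ.≤-pred j<1+k)
    ... | inj₂ refl  = inj₂

    initial-≤ω : ∀ k {x} → x ∈ initial k → x ≤ω u k
    initial-≤ω zero (x≤u , _) = x≤u
    initial-≤ω (1+ k) (inj₁ x∈) = Ω.trans (initial-≤ω k x∈) (proj₁ (u-monotone (ℕ.n≤1+n k)))
    initial-≤ω (1+ k) (inj₂ (x≤u , _)) = x≤u

    upper : ℕ → Lat.Carrier
    upper k = initial k ∪ ↓ P (r k) , initial-generated k ∪ᴳ gen _

    -- `≤ω` keeps `v k` out of `initial k`, which is bounded by `u k`; `≤ᴿ` keeps it out of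
    -- `↓ P (r k)`.
    v∉upper : ∀ k → v k ∉ proj₁ (upper k)
    v∉upper k (inj₁ v∈) = proj₂ (v<u k) (Ω.antisym (initial-≤ω k v∈) (u≤ωv k))
    v∉upper k (inj₂ (_ , v≤r)) = proj₂ (r<v k) (R.antisym (proj₁ (r<v k)) v≤r)

    -- The sets up to `k` are parts of the union. All later ones fit below `r k`, which is beyond
    -- the common bound `α` for `≤ω` and above `u (1+ k)` for `≤ᴿ`.
    u-upper : ∀ k n → ↓ P (u n) ⊆ proj₁ (upper k)
    u-upper k n with ℕ.≤-<-connex n k
    ... | inj₁ n≤k = inj₁ ∘ initial-⊇ k n≤k
    ... | inj₂ k<n = λ x≤un → inj₂ (≤-trans x≤un
      (Ω.trans (u≤ωα n) (α≤ωr k) , R.trans (proj₂ (u-monotone k<n)) (proj₁ (u<r k))))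

    principals : Pred Lat.Carrier (suc 0ℓ)
    principals V = ∃ λ n → V ≡ (↓ P (u n) , gen (u n))

    below-upper : (B : Pred Lat.Carrier (suc 0ℓ)) → ∀ k → (∀ V → V ∈ B → proj₁ (upper k) ⊆ proj₁ V) →
                  Gaps.SeparablePregap (L P) (suc 0ℓ)
    below-upper B k upper⊆B = record
      { A = principals
      ; B = B
      ; pregap = λ { (n , refl) V V∈B x∈ → upper⊆B V V∈B (u-upper k n x∈) }
      ; separable = upper k , (λ { _ (n , refl) → u-upper k n }) , upper⊆B
      }

    ¬selection-sequences : ¬ SelectionProperty (L P) (suc 0ℓ)
    ¬selection-sequences (φ , φ-mono , φ-sep) = v∉upper k (φ≤upper (v∈φ k ℕ.≤-refl))
      where
      S : Gaps.SeparablePregap (L P) (suc 0ℓ)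
      -- For empty `B` every index gives a witness of separability; `0` is arbitrary.
      S = below-upper (λ _ → Lift _ ⊥) 0 λ _ ()

      S′ : ℕ → Gaps.SeparablePregap (L P) (suc 0ℓ)
      S′ k = below-upper (_≡ upper k) k λ { _ refl → id }

      k×v∈φ : Eventually (λ i → v i ∈ proj₁ (φ S))
      k×v∈φ = generated-eventually u-frequently⇒v-eventually (proj₂ (φ S))
        λ k → k , ℕ.≤-refl , proj₁ (φ-sep S) _ (k , refl) ≤-refl

      k : ℕ
      k = proj₁ k×v∈φ

      v∈φ : ∀ i → k ≤ⁿ i → v i ∈ proj₁ (φ S)
      v∈φ = proj₂ k×v∈φ

      φ≤upper : φ S Lat.≤ upper k
      φ≤upper = Lat.trans {φ S} {φ (S′ k)} {upper k}
        (φ-mono ((λ V V∈A → V , V∈A , id) , λ _ ())) (proj₂ (φ-sep (S′ k)) _ refl)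

  module _ (below : ∀ y → ∃ λ z → z <ᴿ y)
           (dense : ∀ α {x y} → x <ᴿ y → ∃ λ z → x <ᴿ z × z <ᴿ y × α ≤ω z) where

    lower-later : ∀ y → ∃ λ z → z <ᴿ y × y ≤ω z
    lower-later y = let _ , x<y = below y
                        z , _ , z<y , y≤z = dense y x<y
                    in z , z<y , y≤z

    u v : ℕ → Carrier
    u zero   = point
    u (1+ n) = proj₁ (lower-later (v n))
    v n = proj₁ (lower-later (u n))

    u<v : ∀ n → u (1+ n) <ᴿ v n
    u<v n = proj₁ (proj₂ (lower-later (v n)))

    ¬selection : ¬ SelectionProperty (L P) (suc 0ℓ)
    -- The bound `α` comes first, so that each `r n` can be chosen beyond it in the interval from
    -- `u (1+ n)` to `v n`.
    ¬selection = let α , u≤α = ω-bounded u in ¬selection-sequences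
      {u} {v} {λ n → proj₁ (dense α (u<v n))} {α}
      (λ n → proj₁ (proj₂ (lower-later (u n)))) u<v
      (λ n → proj₂ (proj₂ (lower-later (u n)))) (λ n → proj₂ (proj₂ (lower-later (v n))))
      u≤α (λ n → proj₂ (proj₂ (proj₂ (dense α (u<v n)))))
      (λ n → proj₁ (proj₂ (dense α (u<v n)))) (λ n → proj₁ (proj₂ (proj₂ (dense α (u<v n)))))

-- Subchains of the real line

ℝ-total : ExcludedMiddle 0ℓ → Total (Poset._≤_ ℝ-poset)
ℝ-total em x y with em {P = ∃ λ q → q ∈ ℝ.lower x × q ∉ ℝ.lower y}
... | no ¬∃ = inj₁ λ {q} q∈x → em⇒dne em λ q∉y → ¬∃ (q , q∈x , q∉y)
... | yes (q , q∈x , q∉y) = inj₂ λ {p} p∈y → case ℚ.<-cmp p q of λ where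
  (tri< p<q _ _)  → ℝ.downClosed x p<q q∈x
  (tri≈ _ refl _) → ⊥-elim (q∉y p∈y)
  (tri> _ _ q<p)  → ⊥-elim (q∉y (ℝ.downClosed y q<p p∈y))

module _ (em : ExcludedMiddle (suc 0ℓ)) (𝕊 : Pred ℝ 0ℓ) {_≤ω₁_ : Rel (Subchain.Carrier 𝕊) 0ℓ}
         (hω₁ : HasOrderTypeω₁ (Subchain.setoid 𝕊) _≤ω₁_) where

  open Subchain 𝕊

  ≤ᴿ-isTotalOrder : IsTotalOrder _≈_ _≤ᴿ_
  ≤ᴿ-isTotalOrder = record
    { isPartialOrder = ≤ᴿ-isPartialOrder
    ; total          = λ x y → ℝ-total (em-lower em) (proj₁ x) (proj₁ y)
    }

  -- Otherwise the interval would lie in the countable segment before `α`, although an uncountable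
  -- set injects into it.
  interval-cofinal : ℵ₁-Dense → ∀ α {x y} → x <ᴿ y → ∃ λ z → x <ᴿ z × z <ᴿ y × α ≤ω₁ z
  interval-cofinal dense α {x} {y} x<y = em⇒dne em λ ¬∃ →
    let _ , _ , hW , W↣xy = dense x y x<y
    in HasOrderTypeω₁.uncountable hW (W↣xy ⟫ (subsetoid-⊆ {X = setoid}
         (λ {z} (x<z , z<y) → ≰⇒>′ _≈_ _≤ω₁_ (λ {x} {y} → Setoid.sym setoid {x} {y})
           ω.reflexive ω.total λ α≤z → ¬∃ (z , x<z , z<y , α≤z))
         ⟫ HasOrderTypeω₁.segmentCountable hω₁ α))
    where module ω = IsTotalOrder (HasOrderTypeω₁.isTotalOrder hω₁)

theorem1p2 : ExcludedMiddle (suc 0ℓ) →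
    (𝕊 : Pred ℝ 0ℓ) →
    let open Subchain 𝕊 in
    ℵ₁-Dense →
    Cardinality≡ℵ₁ setoid →
    WithoutEndpoints →
    (_≤ω₁_ : Rel Carrier 0ℓ) (hω₁ : HasOrderTypeω₁ setoid _≤ω₁_) →
    ChainGapProperty (L (Sierpinskization _≤ω₁_ hω₁)) (suc 0ℓ) ×
    ¬ SelectionProperty (L (Sierpinskization _≤ω₁_ hω₁)) (suc 0ℓ)
theorem1p2 em 𝕊 dense _ noEnds _≤ω₁_ hω₁ =
  (λ A B gap → preserved em setoid hω₁ R≤ po (lower-later em setoid hω₁ R≤ po below int) gap) ,
  ¬selection em setoid hω₁ R≤ po below int
  where
  open Subchain 𝕊
  R≤ = ≤ᴿ-isTotalOrder em 𝕊 hω₁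
  po = Poset.isPartialOrder (Sierpinskization _≤ω₁_ hω₁)
  int = interval-cofinal em 𝕊 hω₁ dense
  below = λ x → proj₁ (noEnds x)
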